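{- $\Xi(4)=5$. More precisely, $\mathfrak{Gr}(n,4)=\emptyset$ for all $n\ge 6$; up to isomorphism, $\mathfrak{Gr}(4,4)$ consists exactly of the cycle $C_4$, the path $P_4$ on 4 vertices, the star $K_{1,3}$, the edgeless graph $E_4$ on 4 vertices, and the disjoint union of the path $P_3$ on 3 vertices with an isolated vertex; and $\mathfrak{Gr}(5,4)$ consists exactly of the cycle $C_5$, the complete bipartite graph $K_{2,3}$, the star $K_{1,4}$, and the graph obtained from a 4-cycle by attaching one new vertex of degree 1 to one of its vertices.
   Context: All graphs are finite, simple and undirected. For a graph $G=(V,E)$ and $x\in V$, $N[x]=\{x\}\cup\{y: xy\in E\}$. A set $C\subseteq V$ is identifying if $N[x]\cap C\ne\emptyset$ for every $x\in V$ and $N[x]\cap C\neq N[y]\cap C$ for all distinct $x,y\in V$. For $n\ge k\ge1$, $\mathfrak{Gr}(n,k)$ is the set of graphs on $n$ vertices in which every $k$-element subset of vertices is identifying, and $\Xi(k)=\max\{n\ge k:\mathfrak{Gr}(n,k)\ne\emptyset\}$. -}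

module Defs where

open import Data.Bool using (Bool; true; false; _∧_; _∨_; not)
open import Data.Bool.Properties using (∨-comm)
open import Data.Nat using (ℕ; _≤_; _≡ᵇ_)
open import Data.Fin using (Fin; toℕ; _≟_)
open import Data.Fin.Subset using (Subset; _∩_; ∣_∣; Nonempty)
open import Data.Fin.Permutation using (Permutation′; _⟨$⟩ʳ_)
open import Data.Vec using (tabulate)
open import Data.List using (List; []; _∷_)
open import Data.Bool.ListAction using (any)
open import Data.Product using (Σ; _×_; _,_)
open import Relation.Nullary using (¬_; yes; no)
open import Relation.Nullary.Decidable using (⌊_⌋)
open import Relation.Binary.PropositionalEquality using (_≡_; _≢_; refl; sym; cong₂)

record Graph (n : ℕ) : Set where
  field
    adj    : Fin n → Fin n → Bool
    adj-sym    : ∀ x y → adj x y ≡ adj y x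
    adj-irrefl : ∀ x → adj x x ≡ false
open Graph public

N[_]_ : ∀ {n} → Fin n → Graph n → Subset n
N[ x ] G = tabulate (λ y → ⌊ x ≟ y ⌋ ∨ adj G x y)

Identifying : ∀ {n} → Graph n → Subset n → Set
Identifying G C =
  (∀ x → Nonempty ((N[ x ] G) ∩ C)) ×
  (∀ x y → x ≢ y → (N[ x ] G) ∩ C ≢ (N[ y ] G) ∩ C)

InGr : ∀ {n} → Graph n → ℕ → Set
InGr {n} G k = (C : Subset n) → ∣ C ∣ ≡ k → Identifying G C

GrNonempty : ℕ → ℕ → Set
GrNonempty n k = Σ (Graph n) (λ G → InGr G k)

IsXi : ℕ → ℕ → Set
IsXi k m = (k ≤ m) × GrNonempty m k × (∀ n → k ≤ n → GrNonempty n k → n ≤ m)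

_≅_ : ∀ {n} → Graph n → Graph n → Set
_≅_ {n} G H = Σ (Permutation′ n) (λ π → ∀ x y → adj G x y ≡ adj H (π ⟨$⟩ʳ x) (π ⟨$⟩ʳ y))

private
  dec-sym : ∀ {n} (x y : Fin n) → ⌊ x ≟ y ⌋ ≡ ⌊ y ≟ x ⌋
  dec-sym x y with x ≟ y | y ≟ x
  ... | yes _ | yes _ = refl
  ... | no _  | no _  = refl
  ... | yes p | no q  with q (sym p)
  ... | ()
  dec-sym x y | no p | yes q with p (sym q)
  ... | ()

  dec-refl : ∀ {n} (x : Fin n) → ⌊ x ≟ x ⌋ ≡ true
  dec-refl x with x ≟ x
  ... | yes _ = refl
  ... | no p with p refl
  ... | ()

data Edge : Set where
  _─_ : ℕ → ℕ → Edge

mem : ∀ {n} → List Edge → Fin n → Fin n → Bool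
mem es x y = any (λ { (a ─ b) → (toℕ x ≡ᵇ a) ∧ (toℕ y ≡ᵇ b) }) es

fromEdges : (n : ℕ) → List Edge → Graph n
fromEdges n es = record
  { adj    = λ x y → not ⌊ x ≟ y ⌋ ∧ (mem es x y ∨ mem es y x)
  ; adj-sym    = λ x y → cong₂ (λ a b → not a ∧ b) (dec-sym x y) (∨-comm (mem es x y) (mem es y x))
  ; adj-irrefl = λ x → cong₂ (λ a b → not a ∧ b) (dec-refl x) refl
  }

C₄ P₄ K₁,₃ E₄ P₃+K₁ : Graph 4
C₄    = fromEdges 4 ((0 ─ 1) ∷ (1 ─ 2) ∷ (2 ─ 3) ∷ (3 ─ 0) ∷ [])
P₄    = fromEdges 4 ((0 ─ 1) ∷ (1 ─ 2) ∷ (2 ─ 3) ∷ [])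
K₁,₃  = fromEdges 4 ((0 ─ 1) ∷ (0 ─ 2) ∷ (0 ─ 3) ∷ [])
E₄    = fromEdges 4 []
P₃+K₁ = fromEdges 4 ((0 ─ 1) ∷ (1 ─ 2) ∷ [])

C₅ K₂,₃ K₁,₄ C₄+pendant : Graph 5
C₅   = fromEdges 5 ((0 ─ 1) ∷ (1 ─ 2) ∷ (2 ─ 3) ∷ (3 ─ 4) ∷ (4 ─ 0) ∷ [])
K₂,₃ = fromEdges 5 ((0 ─ 2) ∷ (0 ─ 3) ∷ (0 ─ 4) ∷ (1 ─ 2) ∷ (1 ─ 3) ∷ (1 ─ 4) ∷ [])
K₁,₄ = fromEdges 5 ((0 ─ 1) ∷ (0 ─ 2) ∷ (0 ─ 3) ∷ (0 ─ 4) ∷ [])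
C₄+pendant = fromEdges 5 ((0 ─ 1) ∷ (1 ─ 2) ∷ (2 ─ 3) ∷ (3 ─ 0) ∷ (0 ─ 4) ∷ [])

{-# OPTIONS --safe #-}
-- The property "every k-subset is identifying" passes to induced subgraphs, because a closed
-- neighbourhood in an induced subgraph is the trace of the closed neighbourhood in the whole graph.
-- Hence every graph in Gr(n+1,k) is a one-vertex extension of a graph in Gr(n,k), and a list of
-- representatives for Gr(n,k) up to isomorphism leaves only finitely many extensions to examine
-- for Gr(n+1,k).  Iterating for k = 4 gives the classification for n = 4 and n = 5 and leaves
-- nothing for n = 6; a graph in Gr(n,4) with n ≥ 6 would have an induced subgraph in Gr(6,4).
module Submission where

open import Defs
open import Data.Bool using (true; false; _∨_)
import Data.Bool.Properties as Bool
open import Data.Empty using (⊥-elim)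
open import Data.Fin using (Fin; zero; suc; inject≤; _≟_)
import Data.Fin.Permutation as Perm
open import Data.Fin.Permutation using (Permutation′; _⟨$⟩ʳ_; _⟨$⟩ˡ_; inverseˡ; inverseʳ)
open import Data.Fin.Properties using (all?; suc-injective; 0≢1+n; inject≤-injective)
open import Data.Fin.Subset using (Subset; inside; outside; _∈_; _∉_; _∩_; ∣_∣; ⊥)
open import Data.Fin.Subset.Properties
  using (∉⊥; ∣⊥∣≡0; nonempty?; x∈p∩q⁺; x∈p∩q⁻; ⊆-antisym)
open import Data.List using (List; []; _∷_; allFin; cartesianProductWith)
import Data.List.Membership.Propositional as List
open import Data.List.Membership.Propositional using (find; lose)
open import Data.List.Membership.Propositional.Properties using (∈-cartesianProductWith⁺)
import Data.List.Relation.Unary.All as All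
open import Data.List.Relation.Unary.All using (All)
import Data.List.Relation.Unary.Any as Any
open import Data.List.Relation.Unary.Any.Properties using (¬Any[])
open import Data.List.Relation.Unary.Any using (Any; here; there)
open import Data.Nat using (ℕ; suc; _≤_)
import Data.Nat.Properties as ℕ
open import Data.Product using (∃; _×_; _,_; proj₁; proj₂)
open import Data.Sum using (_⊎_; inj₁; inj₂)
open import Data.Vec using ([]; _∷_; here; there; lookup; tabulate; _[_]≔_)
open import Data.Vec.Properties
  using (≡-dec; lookup∘tabulate; lookup⇒[]=; []=⇒lookup; []≔-updates; []≔-minimal; lookup∘update′)
open import Function using (_∘_; Injective)
open import Function.Bundles using (_⇔_; mk⇔)
open import Function.Construct.Composition using (_⇔-∘_)
open import Relation.Binary.PropositionalEquality
  using (_≡_; refl; sym; trans; cong; cong₂; subst)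
open import Relation.Nullary using (¬_; Dec; yes; no; does)
open import Relation.Nullary.Decidable
  using (⌊_⌋; map′; isYes≗does; does-⇔; ¬?; _×-dec_; _⊎-dec_; _→-dec_)

private variable
  m n k : ℕ

-- Images of finite sets under maps between vertex sets.

∣[]≔inside∣ : ∀ (p : Subset n) {x} → x ∉ p → ∣ p [ x ]≔ inside ∣ ≡ suc ∣ p ∣
∣[]≔inside∣ (inside  ∷ p) {zero}  x∉p = ⊥-elim (x∉p here)
∣[]≔inside∣ (outside ∷ p) {zero}  x∉p = refl
∣[]≔inside∣ (inside  ∷ p) {suc x} x∉p = cong suc (∣[]≔inside∣ p (x∉p ∘ there))
∣[]≔inside∣ (outside ∷ p) {suc x} x∉p = ∣[]≔inside∣ p (x∉p ∘ there)

image : (Fin m → Fin n) → Subset m → Subset n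
image f []            = ⊥
image f (inside  ∷ p) = image (f ∘ suc) p [ f zero ]≔ inside
image f (outside ∷ p) = image (f ∘ suc) p

∈-image⁺ : ∀ (f : Fin m → Fin n) {p x} → x ∈ p → f x ∈ image f p
∈-image⁺ f {inside ∷ p}  here      = []≔-updates (image (f ∘ suc) p) (f zero)
∈-image⁺ f {outside ∷ p} (there i) = ∈-image⁺ (f ∘ suc) i
∈-image⁺ f {inside ∷ p} {suc x} (there i) with f (suc x) ≟ f zero
... | yes e  = subst (_∈ image (f ∘ suc) p [ f zero ]≔ inside) (sym e)
                 ([]≔-updates (image (f ∘ suc) p) (f zero))
... | no  ne = []≔-minimal (image (f ∘ suc) p) (f (suc x)) (f zero) ne (∈-image⁺ (f ∘ suc) i)

∈-image⁻ : ∀ (f : Fin m → Fin n) p {y} → y ∈ image f p → ∃ λ x → x ∈ p × f x ≡ y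
∈-image⁻ f []            i = ⊥-elim (∉⊥ i)
∈-image⁻ f (outside ∷ p) i =
  let x , x∈p , e = ∈-image⁻ (f ∘ suc) p i in suc x , there x∈p , e
∈-image⁻ f (inside ∷ p) {y} i with f zero ≟ y
... | yes e  = zero , here , e
... | no  ne = let x , x∈p , e = ∈-image⁻ (f ∘ suc) p y∈p in suc x , there x∈p , e
  where
  y∈p : y ∈ image (f ∘ suc) p
  y∈p = lookup⇒[]= y _
    (trans (sym (lookup∘update′ (ne ∘ sym) (image (f ∘ suc) p) inside)) ([]=⇒lookup i))

-- Injectivity keeps `f zero` outside the image of the tail, so every update turns on a new bit.
∣image∣ : ∀ {f : Fin m → Fin n} → Injective _≡_ _≡_ f → ∀ p → ∣ image f p ∣ ≡ ∣ p ∣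
∣image∣ {n = n} inj []   = ∣⊥∣≡0 n
∣image∣ inj (outside ∷ p) = ∣image∣ (suc-injective ∘ inj) p
∣image∣ {f = f} inj (inside ∷ p) = trans
  (∣[]≔inside∣ _ λ i → let x , _ , e = ∈-image⁻ (f ∘ suc) p i in 0≢1+n (sym (inj e)))
  (cong suc (∣image∣ (suc-injective ∘ inj) p))

-- Identifying sets along an induced embedding.

module _ (G : Graph m) (H : Graph n) (f : Fin m → Fin n) (inj : Injective _≡_ _≡_ f)
         (adj-f : ∀ x y → adj G x y ≡ adj H (f x) (f y)) where

  private
    ≟-f : ∀ x y → ⌊ x ≟ y ⌋ ≡ ⌊ f x ≟ f y ⌋
    ≟-f x y = trans (isYes≗does (x ≟ y)) (trans
      (does-⇔ (mk⇔ (cong f) inj) (x ≟ y) (f x ≟ f y))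
      (sym (isYes≗does (f x ≟ f y))))

    lookup-N : ∀ x y → lookup (N[ x ] G) y ≡ lookup (N[ f x ] H) (f y)
    lookup-N x y = trans (lookup∘tabulate _ y) (trans
      (cong₂ _∨_ (≟-f x y) (adj-f x y))
      (sym (lookup∘tabulate _ (f y))))

    ∈-N⁺ : ∀ {x y} → y ∈ N[ x ] G → f y ∈ N[ f x ] H
    ∈-N⁺ {x} {y} i = lookup⇒[]= _ _ (trans (sym (lookup-N x y)) ([]=⇒lookup i))

    ∈-N⁻ : ∀ {x y} → f y ∈ N[ f x ] H → y ∈ N[ x ] G
    ∈-N⁻ {x} {y} i = lookup⇒[]= _ _ (trans (lookup-N x y) ([]=⇒lookup i))

    trace⁻ : ∀ {x y} C → y ∈ N[ f x ] H ∩ image f C → ∃ λ z → z ∈ N[ x ] G ∩ C × f z ≡ y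
    trace⁻ C i with x∈p∩q⁻ _ _ i
    ... | y∈N , y∈C with ∈-image⁻ f C y∈C
    ...   | z , z∈C , refl = z , x∈p∩q⁺ (∈-N⁻ y∈N , z∈C) , refl

    trace⁺ : ∀ {x z} C → z ∈ N[ x ] G ∩ C → f z ∈ N[ f x ] H ∩ image f C
    trace⁺ C i = let z∈N , z∈C = x∈p∩q⁻ _ _ i in x∈p∩q⁺ (∈-N⁺ z∈N , ∈-image⁺ f z∈C)

    trace-mono : ∀ {x y} C → N[ x ] G ∩ C ≡ N[ y ] G ∩ C →
                 ∀ {z} → z ∈ N[ f x ] H ∩ image f C → z ∈ N[ f y ] H ∩ image f C
    trace-mono C e i with trace⁻ C i
    ... | z , z∈ , refl = trace⁺ C (subst (z ∈_) e z∈)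

  -- Since `f` preserves cardinality, `image f C` is again a `k`-subset, and its trace on
  -- `N[ f x ] H` is the `f`-image of `N[ x ] G ∩ C`. Nonemptiness and distinctness of traces
  -- therefore pull back to `G`. A bijective `f` gives invariance under isomorphism.
  InGr-induced : InGr H k → InGr G k
  InGr-induced H∈Gr C ∣C∣≡k with H∈Gr (image f C) (trans (∣image∣ inj C) ∣C∣≡k)
  ... | dominating , separating =
      (λ x → let _ , i = dominating (f x); z , z∈ , _ = trace⁻ C i in z , z∈)
    , (λ x y x≢y e → separating (f x) (f y) (x≢y ∘ inj)
         (⊆-antisym (trace-mono C e) (trace-mono C (sym e))))

-- Isomorphisms and one-vertex extensions.

Isomorphism : Graph n → Graph n → Permutation′ n → Set
Isomorphism G H π = ∀ x y → adj G x y ≡ adj H (π ⟨$⟩ʳ x) (π ⟨$⟩ʳ y)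

⟨$⟩ʳ-injective : (π : Permutation′ n) → Injective _≡_ _≡_ (π ⟨$⟩ʳ_)
⟨$⟩ʳ-injective π e = trans (sym (inverseˡ π)) (trans (cong (π ⟨$⟩ˡ_) e) (inverseˡ π))

≅-sym : (G H : Graph n) → G ≅ H → H ≅ G
≅-sym G H (π , iso) = Perm.flip π , λ x y →
  sym (trans (iso _ _) (cong₂ (adj H) (inverseʳ π) (inverseʳ π)))

≅-trans : (G H K : Graph n) → G ≅ H → H ≅ K → G ≅ K
≅-trans G H K (π , iso) (ρ , iso′) = π Perm.∘ₚ ρ , λ x y → trans (iso x y) (iso′ _ _)

InGr-≅ : (G H : Graph n) → G ≅ H → InGr H k → InGr G k
InGr-≅ G H (π , iso) = InGr-induced G H (π ⟨$⟩ʳ_) (⟨$⟩ʳ-injective π) iso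

induced : (Fin m → Fin n) → Graph n → Graph m
induced f G .adj x y      = adj G (f x) (f y)
induced f G .adj-sym x y  = adj-sym G (f x) (f y)
induced f G .adj-irrefl x = adj-irrefl G (f x)

extend : Subset n → Graph n → Graph (suc n)
extend S G .adj zero    zero    = false
extend S G .adj zero    (suc y) = lookup S y
extend S G .adj (suc x) zero    = lookup S x
extend S G .adj (suc x) (suc y) = adj G x y
extend S G .adj-sym zero    zero    = refl
extend S G .adj-sym zero    (suc y) = refl
extend S G .adj-sym (suc x) zero    = refl
extend S G .adj-sym (suc x) (suc y) = adj-sym G x y
extend S G .adj-irrefl zero    = refl
extend S G .adj-irrefl (suc x) = adj-irrefl G x

-- Vertex `zero` of `G` plays the new vertex, and its neighbourhood carried over by `π` is `S`;
-- `Perm.lift₀` fixes the new vertex and acts as `π` on the others.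
≅-extend : ∀ (G : Graph (suc n)) (H : Graph n) → induced suc G ≅ H → ∃ λ S → G ≅ extend S H
≅-extend {n} G H (π , iso) = S , Perm.lift₀ π , λ where
    zero    zero    → adj-irrefl G zero
    zero    (suc y) → row y
    (suc x) zero    → trans (adj-sym G (suc x) zero) (row x)
    (suc x) (suc y) → iso x y
  where
  S : Subset n
  S = tabulate λ y → adj G zero (suc (π ⟨$⟩ˡ y))

  row : ∀ y → adj G zero (suc y) ≡ lookup S (π ⟨$⟩ʳ y)
  row y = sym (trans (lookup∘tabulate _ (π ⟨$⟩ʳ y)) (cong (adj G zero ∘ suc) (inverseˡ π)))

-- Exhaustive enumeration and decision procedures.

subsets : ∀ n → List (Subset n)
subsets 0       = [] ∷ []
subsets (suc n) = cartesianProductWith _∷_ (inside ∷ outside ∷ []) (subsets n)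

∈-subsets : (S : Subset n) → S List.∈ subsets n
∈-subsets []            = here refl
∈-subsets (inside  ∷ S) =
  ∈-cartesianProductWith⁺ _∷_ {xs = inside ∷ outside ∷ []} (here refl) (∈-subsets S)
∈-subsets (outside ∷ S) =
  ∈-cartesianProductWith⁺ _∷_ {xs = inside ∷ outside ∷ []} (there (here refl)) (∈-subsets S)

-- `Perm.insert zero` chooses the image of `zero`; recursion supplies the rest. These are candidates
-- for a search: any hit is a genuine isomorphism, so soundness does not depend on the list being
-- complete.
permutations : ∀ n → List (Permutation′ n)
permutations 0       = Perm.id ∷ []
permutations (suc n) = cartesianProductWith (Perm.insert zero) (allFin (suc n)) (permutations n)

identifying? : (G : Graph n) (C : Subset n) → Dec (Identifying G C)
identifying? G C =
  all? (λ x → nonempty? (N[ x ] G ∩ C)) ×-dec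
  all? (λ x → all? (λ y → ¬? (x ≟ y) →-dec ¬? (≡-dec Bool._≟_ (N[ x ] G ∩ C) (N[ y ] G ∩ C))))

inGr? : ∀ k (G : Graph n) → Dec (InGr G k)
inGr? {n} k G = map′
  (λ all C → All.lookup all (∈-subsets C))
  (λ G∈Gr → All.tabulate λ {C} _ → G∈Gr C)
  (All.all? (λ C → (∣ C ∣ ℕ.≟ k) →-dec identifying? G C) (subsets n))

-- The hypothesis mentions only the Boolean of `a?`, so `refl` makes the type checker compute that
-- Boolean while the proof terms can stay unevaluated.
from-does : ∀ {a} {A : Set a} (a? : Dec A) → does a? ≡ true → A
from-does (yes a) refl = a

-- Covering lists: extension and pruning.

Covers : ℕ → List (Graph n) → Set
Covers k Hs = ∀ G → InGr G k → Any (G ≅_) Hs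

extensions : List (Graph n) → List (Graph (suc n))
extensions {n} Hs = cartesianProductWith extend (subsets n) Hs

-- Deleting vertex `zero` stays inside the class by `InGr-induced`, so the rest is isomorphic to
-- some listed `H`; putting the vertex back gives an extension of `H`.
covers-extensions : {Hs : List (Graph n)} → Covers k Hs → Covers k (extensions Hs)
covers-extensions {n} covers G G∈Gr =
  let H , H∈Hs , iso = find (covers G⁻ (InGr-induced G⁻ G suc suc-injective (λ _ _ → refl) G∈Gr))
      S , iso′       = ≅-extend G H iso
  in lose (∈-cartesianProductWith⁺ extend (∈-subsets S) H∈Hs) iso′
  where
  G⁻ : Graph n
  G⁻ = induced suc G

-- A decidable certificate for one candidate: either it fails `InGr`, or a listed permutation
-- matches it with a representative.
Sorted : ℕ → List (Graph n) → Graph n → Set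
Sorted {n} k Ks H = ¬ InGr H k ⊎ Any (λ K → Any (Isomorphism H K) (permutations n)) Ks

sorted? : ∀ k (Ks : List (Graph n)) H → Dec (Sorted k Ks H)
sorted? {n} k Ks H =
  ¬? (inGr? k H) ⊎-dec Any.any? (λ K → Any.any? (isomorphism? K) (permutations n)) Ks
  where
  isomorphism? : ∀ K π → Dec (Isomorphism H K π)
  isomorphism? K π = all? λ x → all? λ y → adj H x y Bool.≟ adj K (π ⟨$⟩ʳ x) (π ⟨$⟩ʳ y)

-- Membership in the class is invariant under isomorphism, so a rejected candidate cannot be
-- isomorphic to `G`; a matched one passes `G` on to its representative by transitivity.
covers-sort : {Hs Ks : List (Graph n)} → All (Sorted k Ks) Hs → Covers k Hs → Covers k Ks
covers-sort sorted covers G G∈Gr with find (covers G G∈Gr)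
... | H , H∈Hs , G≅H with All.lookup sorted H∈Hs
...   | inj₁ H∉Gr = ⊥-elim (H∉Gr (InGr-≅ H G (≅-sym G H G≅H) G∈Gr))
...   | inj₂ any  = Any.map (λ {K} → ≅-trans G H K G≅H ∘ Any.satisfied) any

Representatives : ℕ → List (Graph n) → Set
Representatives k Hs = Covers k Hs × All (λ H → InGr H k) Hs

InGr⇔≅ : {Hs : List (Graph n)} → Representatives k Hs → ∀ G → InGr G k ⇔ Any (G ≅_) Hs
InGr⇔≅ (covers , Hs∈Gr) G = mk⇔ (covers G) λ any →
  let H , H∈Hs , G≅H = find any in InGr-≅ G H G≅H (All.lookup Hs∈Gr H∈Hs)

labelled : ∀ n → List (Graph n)
labelled 0       = fromEdges 0 [] ∷ []
labelled (suc n) = extensions (labelled n)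

-- On fewer than `k` vertices `InGr` holds vacuously and excludes nothing, so the search starts from
-- all labelled graphs, grown from the empty one.
covers-labelled : ∀ n → Covers k (labelled n)
covers-labelled 0       G _ = here (Perm.id , λ ())
covers-labelled (suc n)     = covers-extensions (covers-labelled n)

-- The classification for `k = 4`.

Gr-4-4 : List (Graph 4)
Gr-4-4 = C₄ ∷ P₄ ∷ K₁,₃ ∷ E₄ ∷ P₃+K₁ ∷ []

Gr-5-4 : List (Graph 5)
Gr-5-4 = C₅ ∷ K₂,₃ ∷ K₁,₄ ∷ C₄+pendant ∷ []

representatives-4-4 : Representatives 4 Gr-4-4
representatives-4-4 =
    covers-sort
      -- There are 64 labelled graphs, each rejected or matched by one of 24 permutations.
      (from-does (All.all? (sorted? 4 Gr-4-4) (labelled 4)) refl)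
      (covers-labelled 4)
  , from-does (All.all? (inGr? 4) Gr-4-4) refl

representatives-5-4 : Representatives 4 Gr-5-4
representatives-5-4 =
    covers-sort
      -- Five representatives and 16 possible neighbourhoods of a fifth vertex give 80 candidates.
      (from-does (All.all? (sorted? 4 Gr-5-4) (extensions Gr-4-4)) refl)
      (covers-extensions (proj₁ representatives-4-4))
  , from-does (All.all? (inGr? 4) Gr-5-4) refl

covers-Gr-6-4 : Covers {6} 4 []
covers-Gr-6-4 =
  covers-sort
    -- With no representative to match, the check succeeds only because all 4 * 32 = 128 extensions
    -- fail `InGr`.
    (from-does (All.all? (sorted? 4 []) (extensions Gr-5-4)) refl)
    (covers-extensions (proj₁ representatives-5-4))

Gr-6-4-empty : (G : Graph 6) → ¬ InGr G 4
Gr-6-4-empty G G∈Gr = ¬Any[] (covers-Gr-6-4 G G∈Gr)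

Gr-n-4-empty : ∀ n → 6 ≤ n → ¬ GrNonempty n 4
Gr-n-4-empty n 6≤n (G , G∈Gr) = Gr-6-4-empty (induced ι G)
    (InGr-induced (induced ι G) G ι (inject≤-injective 6≤n 6≤n _ _) (λ _ _ → refl) G∈Gr)
  where
  ι : Fin 6 → Fin n
  ι x = inject≤ x 6≤n

Gr-4-4-⊎ : ∀ G → Any (G ≅_) Gr-4-4 ⇔ (G ≅ C₄ ⊎ G ≅ P₄ ⊎ G ≅ K₁,₃ ⊎ G ≅ E₄ ⊎ G ≅ P₃+K₁)
Gr-4-4-⊎ G = mk⇔
  (λ { (here i)                                 → inj₁ i
     ; (there (here i))                         → inj₂ (inj₁ i)
     ; (there (there (here i)))                 → inj₂ (inj₂ (inj₁ i))
     ; (there (there (there (here i))))         → inj₂ (inj₂ (inj₂ (inj₁ i)))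
     ; (there (there (there (there (here i))))) → inj₂ (inj₂ (inj₂ (inj₂ i))) })
  (λ { (inj₁ i)                      → here i
     ; (inj₂ (inj₁ i))               → there (here i)
     ; (inj₂ (inj₂ (inj₁ i)))        → there (there (here i))
     ; (inj₂ (inj₂ (inj₂ (inj₁ i)))) → there (there (there (here i)))
     ; (inj₂ (inj₂ (inj₂ (inj₂ i)))) → there (there (there (there (here i)))) })

Gr-5-4-⊎ : ∀ G → Any (G ≅_) Gr-5-4 ⇔ (G ≅ C₅ ⊎ G ≅ K₂,₃ ⊎ G ≅ K₁,₄ ⊎ G ≅ C₄+pendant)
Gr-5-4-⊎ G = mk⇔
  (λ { (here i)                         → inj₁ i
     ; (there (here i))                 → inj₂ (inj₁ i)
     ; (there (there (here i)))         → inj₂ (inj₂ (inj₁ i))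
     ; (there (there (there (here i)))) → inj₂ (inj₂ (inj₂ i)) })
  (λ { (inj₁ i)               → here i
     ; (inj₂ (inj₁ i))        → there (here i)
     ; (inj₂ (inj₂ (inj₁ i))) → there (there (here i))
     ; (inj₂ (inj₂ (inj₂ i))) → there (there (there (here i))) })

theorem17 : IsXi 4 5
    × (∀ n → 6 ≤ n → ¬ GrNonempty n 4)
    × (∀ (G : Graph 4) → InGr G 4 ⇔ (G ≅ C₄ ⊎ G ≅ P₄ ⊎ G ≅ K₁,₃ ⊎ G ≅ E₄ ⊎ G ≅ P₃+K₁))
    × (∀ (G : Graph 5) → InGr G 4 ⇔ (G ≅ C₅ ⊎ G ≅ K₂,₃ ⊎ G ≅ K₁,₄ ⊎ G ≅ C₄+pendant))
theorem17 =
    ( ℕ.n≤1+n 4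
    , (C₅ , All.head (proj₂ representatives-5-4))
    -- `5 < n` unfolds to `6 ≤ n`, so emptiness from 6 on gives the upper bound 5.
    , λ n _ nonempty → ℕ.≮⇒≥ (λ 5<n → Gr-n-4-empty n 5<n nonempty))
  , Gr-n-4-empty
  , (λ G → Gr-4-4-⊎ G ⇔-∘ InGr⇔≅ representatives-4-4 G)
  , (λ G → Gr-5-4-⊎ G ⇔-∘ InGr⇔≅ representatives-5-4 G)
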